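{- There is no generalized bent function of type $[1,42]$, i.e. no function $f:\mathbb{Z}/42\mathbb{Z}\to\mathbb{Z}/42\mathbb{Z}$ such that $\left|\sum_{x\in\mathbb{Z}/42\mathbb{Z}}\zeta_{42}^{f(x)-\lambda x}\right|^2=42$ for all $\lambda\in\mathbb{Z}/42\mathbb{Z}$, where $\zeta_{42}=e^{2\pi i/42}$.
   Context: A generalized bent function of type $[n,q]$ is a function $f:(\mathbb{Z}/q\mathbb{Z})^n\to\mathbb{Z}/q\mathbb{Z}$ with $|\sum_{x}e^{2\pi i (f(x)-\lambda\cdot x)/q}|^2=q^n$ for all $\lambda\in(\mathbb{Z}/q\mathbb{Z})^n$. -}

module Defs where

open import Data.Nat using (ℕ; zero; suc)
import Data.Nat as ℕ
open import Data.Nat.DivMod using (_%_)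
open import Data.Integer using (ℤ; +_; -[1+_]; _+_; _*_)
open import Data.Fin using (Fin; toℕ)
open import Data.Vec using (Vec; []; _∷_; zipWith; map; replicate; init; last; toList)
import Data.List as List
open import Relation.Binary.PropositionalEquality using (_≡_)

-- The ring ℤ[ζ₄₂] ⊂ ℂ, modelled exactly as ℤ[X]/(Φ₄₂(X)), where
-- Φ₄₂(X) = X^12 + X^11 - X^9 - X^8 + X^6 - X^4 - X^3 + X + 1
-- is the 42nd cyclotomic polynomial (the minimal polynomial of ζ₄₂ = e^{2πi/42}).
-- An element is its coefficient vector (c₀,…,c₁₁) w.r.t. 1, ζ, …, ζ^11;
-- this representation is unique, so equality of elements is ≡ on vectors.
Cyc : Set
Cyc = Vec ℤ 12

zeroC : Cyc
zeroC = replicate 12 (+ 0)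

oneC : Cyc
oneC = + 1 ∷ replicate 11 (+ 0)

fortytwo : Cyc
fortytwo = + 42 ∷ replicate 11 (+ 0)

_⊕_ : Cyc → Cyc → Cyc
_⊕_ = zipWith _+_

scale : ℤ → Cyc → Cyc
scale c = map (c *_)

-- ζ^12 reduced modulo Φ₄₂:  -1 - ζ + ζ^3 + ζ^4 - ζ^6 + ζ^8 + ζ^9 - ζ^11
ζ¹² : Cyc
ζ¹² = -[1+ 0 ] ∷ -[1+ 0 ] ∷ + 0 ∷ + 1 ∷ + 1 ∷ + 0 ∷ -[1+ 0 ] ∷ + 0 ∷ + 1 ∷ + 1 ∷ + 0 ∷ -[1+ 0 ] ∷ []

mulζ : Cyc → Cyc
mulζ v = (+ 0 ∷ init v) ⊕ scale (last v) ζ¹²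

-- ring multiplication (Horner scheme on the coefficients of the left factor)
_⊗_ : Cyc → Cyc → Cyc
u ⊗ v = List.foldr (λ c acc → scale c v ⊕ mulζ acc) zeroC (toList u)

ζ^ : ℕ → Cyc
ζ^ zero    = oneC
ζ^ (suc k) = mulζ (ζ^ k)

-- ζ^k for k read modulo 42 (ζ^42 = 1, so this is the same element)
ζpow : ℕ → Cyc
ζpow k = ζ^ (k % 42)

Σ42 : (Fin 42 → Cyc) → Cyc
Σ42 g = List.foldr (λ x acc → g x ⊕ acc) zeroC (List.allFin 42)

-- Elements of ℤ/42ℤ are represented by Fin 42 (residues 0..41).
-- Exponent (f(x) - λ·x) mod 42, computed as f(x) + 41·λ·x  (since -1 ≡ 41 mod 42).
expo : (Fin 42 → Fin 42) → Fin 42 → Fin 42 → ℕ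
expo f λ′ x = toℕ (f x) ℕ.+ 41 ℕ.* (toℕ λ′ ℕ.* toℕ x)

S : (Fin 42 → Fin 42) → Fin 42 → Cyc
S f λ′ = Σ42 (λ x → ζpow (expo f λ′ x))

-- complex conjugate of S_f(λ): Σ_x ζ^{-(f(x) - λx)}, using conj(ζ^k) = ζ^{-k} = ζ^{41k}
Sconj : (Fin 42 → Fin 42) → Fin 42 → Cyc
Sconj f λ′ = Σ42 (λ x → ζpow (41 ℕ.* expo f λ′ x))

IsGBent[1,42] : (Fin 42 → Fin 42) → Set
IsGBent[1,42] f = ∀ (λ′ : Fin 42) → (S f λ′ ⊗ Sconj f λ′) ≡ fortytwo

{-# OPTIONS --safe #-}
module Submission where

-- For l < 21 write S(l) = A + B and S(l + 21) = A − B, where A and B collect the even and the odd x.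
-- The two norm equations give A Ā + B B̄ = 42. The prime 2 splits as Q Q̄ in ℤ[ζ₄₂], both residue fields
-- being 𝔽₆₄. Modulo Q the equations read (A + B)(Ā + B̄) ≡ 0 and A Ā + B B̄ ≡ 0, while A + B cannot lie in
-- Q ∩ Q̄ = (2): it would be 2 T with T · conj(A + B) = 21 and conj(A + B) ∈ Q. Hence A Ā ≡ 0 modulo Q for
-- every l. But by Parseval the sum of A Ā over l < 21 is 21 · 21, which is odd.

-- Modulo 2 the polynomial Φ₄₂ equals Φ₂₁. It has two irreducible factors of degree 6, since 2 has
-- order 6 modulo 21, and conjugation exchanges them, since -1 is not a power of 2 modulo 21. This
-- is the obstacle: were Q equal to Q̄, the valuation of S S̄ at Q would be even, whereas that of 42
-- is 1. With Q ≠ Q̄ a single equation S S̄ = 42 says only that S lies in exactly one of Q and Q̄,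
-- so several λ have to be combined. The pairing of l with l + 21 works because ζ^21 = -1 flips the
-- sign of the odd x alone. The two norm equations add up to 2 (A Ā + B B̄) = 84, which is void
-- modulo 2; it has to be halved in ℤ[ζ₄₂] before it is reduced.

open import Defs
open import Algebra.Bundles using (CommutativeMonoid; CommutativeRing)
open import Algebra.Core using (Op₂)
import Algebra.Properties.CommutativeSemigroup as CommutativeSemigroupProperties
open import Algebra.Structures using (IsCommutativeSemiring)
open import Data.Bool using (Bool; true; false; not; _∧_; _xor_; if_then_else_)
import Data.Bool.Properties as Bool
open import Data.Fin using (Fin; toℕ; _↑ˡ_; _↑ʳ_)
import Data.Fin.Properties as Fin
open import Data.Integer as ℤ using (ℤ; +_; -[1+_]; ∣_∣; _⊖_)
import Data.Integer.Properties as ℤ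
import Data.Integer.Tactic.RingSolver as ℤ-Solver
open import Data.List as List using (List; []; _∷_; allFin)
import Data.List.Properties as List
open import Data.Nat as ℕ using (ℕ; zero; suc; _+_; _*_)
open import Data.Nat.DivMod using (_%_; _/_; m≡m%n+[m/n]*n)
import Data.Nat.Properties as ℕ
open import Data.Nat.Tactic.RingSolver using (solve-∀)
open import Data.Product using (Σ; ∃; _,_; proj₁; proj₂)
open import Data.Sum using (_⊎_; inj₁; inj₂)
open import Data.Unit using (tt)
open import Data.Vec using (Vec; []; _∷_; zipWith; map; replicate; init; last; toList)
import Data.Vec.Properties as Vec
open import Function using (_∘_; const)
open import Level using (0ℓ)
open import Relation.Binary.PropositionalEquality using (_≡_; _≢_; refl; sym; trans; cong; cong₂; isEquivalence; module ≡-Reasoning)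
open import Relation.Nullary using (¬_; contradiction; Dec; yes; no; does; _→-dec_; _×-dec_; _⊎-dec_)
open import Relation.Nullary.Decidable using (map′; toWitness)

open ≡-Reasoning

-- Linear algebra over a commutative semiring

module Coefficients {A : Set} {_+ᴬ_ _*ᴬ_ : Op₂ A} {0ᴬ 1ᴬ : A}
                    (isSemiring : IsCommutativeSemiring _≡_ _+ᴬ_ _*ᴬ_ 0ᴬ 1ᴬ) where

  open IsCommutativeSemiring isSemiring
    using (+-assoc; +-comm; +-identityˡ; +-identityʳ; *-assoc; *-comm; *-identityˡ; distribˡ; distribʳ; zeroˡ; zeroʳ)

  infixl 6 _⊞_
  infixr 7 _•_

  _⊞_ : ∀ {n} → Op₂ (Vec A n)
  _⊞_ = zipWith _+ᴬ_

  _•_ : ∀ {n} → A → Vec A n → Vec A n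
  c • v = map (c *ᴬ_) v

  𝟘 : ∀ {n} → Vec A n
  𝟘 = replicate _ 0ᴬ

  ⊞-commutativeMonoid : ℕ → CommutativeMonoid 0ℓ 0ℓ
  ⊞-commutativeMonoid n = record
    { Carrier = Vec A n
    ; isCommutativeMonoid = record
      { isMonoid = record
        { isSemigroup = record
          { isMagma = record { isEquivalence = isEquivalence ; ∙-cong = cong₂ _⊞_ }
          ; assoc = Vec.zipWith-assoc +-assoc
          }
        ; identity = Vec.zipWith-identityˡ +-identityˡ , Vec.zipWith-identityʳ +-identityʳ
        }
      ; comm = Vec.zipWith-comm +-comm
      }
    }

  module _ {n : ℕ} where
    open CommutativeMonoid (⊞-commutativeMonoid n) public
      using () renaming (identityˡ to ⊞-identityˡ; identityʳ to ⊞-identityʳ; assoc to ⊞-assoc)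
    open CommutativeSemigroupProperties (CommutativeMonoid.commutativeSemigroup (⊞-commutativeMonoid n)) public
      using () renaming (interchange to ⊞-interchange)

  •-distribˡ : ∀ {n} c (u v : Vec A n) → c • (u ⊞ v) ≡ c • u ⊞ c • v
  •-distribˡ c []      []      = refl
  •-distribˡ c (x ∷ u) (y ∷ v) = cong₂ _∷_ (distribˡ c x y) (•-distribˡ c u v)

  •-distribʳ : ∀ {n} c d (v : Vec A n) → (c +ᴬ d) • v ≡ c • v ⊞ d • v
  •-distribʳ c d []      = refl
  •-distribʳ c d (x ∷ v) = cong₂ _∷_ (distribʳ x c d) (•-distribʳ c d v)

  •-assoc : ∀ {n} c d (v : Vec A n) → (c *ᴬ d) • v ≡ c • d • v
  •-assoc c d []      = refl
  •-assoc c d (x ∷ v) = cong₂ _∷_ (*-assoc c d x) (•-assoc c d v)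

  •-comm : ∀ {n} c d (v : Vec A n) → c • d • v ≡ d • c • v
  •-comm c d v = trans (sym (•-assoc c d v)) (trans (cong (_• v) (*-comm c d)) (•-assoc d c v))

  •-identity : ∀ {n} (v : Vec A n) → 1ᴬ • v ≡ v
  •-identity []      = refl
  •-identity (x ∷ v) = cong₂ _∷_ (*-identityˡ x) (•-identity v)

  •-zeroˡ : ∀ {n} (v : Vec A n) → 0ᴬ • v ≡ 𝟘
  •-zeroˡ []      = refl
  •-zeroˡ (x ∷ v) = cong₂ _∷_ (zeroˡ x) (•-zeroˡ v)

  •-zeroʳ : ∀ c n → c • 𝟘 {n} ≡ 𝟘
  •-zeroʳ c zero    = refl
  •-zeroʳ c (suc n) = cong₂ _∷_ (zeroʳ c) (•-zeroʳ c n)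

  record IsLinear {m n} (M : Vec A m → Vec A n) : Set where
    field
      additive    : ∀ u v → M (u ⊞ v) ≡ M u ⊞ M v
      homogeneous : ∀ c v → M (c • v) ≡ c • M v

    preserves-𝟘 : M 𝟘 ≡ 𝟘
    preserves-𝟘 = begin
      M 𝟘        ≡⟨ cong M (•-zeroˡ 𝟘) ⟨
      M (0ᴬ • 𝟘) ≡⟨ homogeneous 0ᴬ 𝟘 ⟩
      0ᴬ • M 𝟘   ≡⟨ •-zeroˡ _ ⟩
      𝟘          ∎

  init-⊞ : ∀ {n} (u v : Vec A (suc n)) → init (u ⊞ v) ≡ init u ⊞ init v
  init-⊞ {zero}  (x ∷ []) (y ∷ []) = refl
  init-⊞ {suc n} (x ∷ u)  (y ∷ v)  = cong (_ ∷_) (init-⊞ u v)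

  last-⊞ : ∀ {n} (u v : Vec A (suc n)) → last (u ⊞ v) ≡ last u +ᴬ last v
  last-⊞ {zero}  (x ∷ []) (y ∷ []) = refl
  last-⊞ {suc n} (x ∷ u)  (y ∷ v)  = last-⊞ u v

  -- Multiplication by X in A[X]/(Xⁿ⁺¹ − r).
  mulX : ∀ {n} → Vec A (suc n) → Vec A (suc n) → Vec A (suc n)
  mulX r v = (0ᴬ ∷ init v) ⊞ last v • r

  -- The polynomial with coefficients `u`, evaluated at the operator `M` and applied to `v`. At
  -- `mulζ` it is `_⊗_`, at `θ·` the product of 𝔽₆₄. As `m` and `n` are independent, the 12
  -- coefficients of a `Cyc` can be evaluated in the 6-dimensional 𝔽₆₄.
  horner : ∀ {m n} → (Vec A n → Vec A n) → Vec A m → Vec A n → Vec A n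
  horner M u v = List.foldr (λ c acc → c • v ⊞ M acc) 𝟘 (toList u)

  iterate : ∀ {n} → (Vec A n → Vec A n) → ℕ → Vec A n → Vec A n
  iterate M zero    v = v
  iterate M (suc k) v = M (iterate M k v)

  ∑ : ∀ {n} {I : Set} → List I → (I → Vec A n) → Vec A n
  ∑ is g = List.foldr (λ i acc → g i ⊞ acc) 𝟘 is

  ∑-cong : ∀ {n} {I : Set} {g h : I → Vec A n} → (∀ i → g i ≡ h i) → ∀ is → ∑ is g ≡ ∑ is h
  ∑-cong g≗h = List.foldr-cong (λ i acc → cong (_⊞ acc) (g≗h i)) refl

  ∑-𝟘 : ∀ {n} {I : Set} (is : List I) → ∑ is (const (𝟘 {n})) ≡ 𝟘
  ∑-𝟘 []       = refl
  ∑-𝟘 (i ∷ is) = trans (⊞-identityˡ _) (∑-𝟘 is)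

  ∑-⊞ : ∀ {n} {I : Set} (g h : I → Vec A n) is → ∑ is (λ i → g i ⊞ h i) ≡ ∑ is g ⊞ ∑ is h
  ∑-⊞ g h []       = sym (⊞-identityˡ 𝟘)
  ∑-⊞ g h (i ∷ is) = trans (cong (g i ⊞ h i ⊞_) (∑-⊞ g h is)) (⊞-interchange (g i) (h i) _ _)

  ∑-comm : ∀ {n} {I J : Set} (g : I → J → Vec A n) is js →
           ∑ is (λ i → ∑ js (g i)) ≡ ∑ js (λ j → ∑ is (λ i → g i j))
  ∑-comm g []       js = sym (∑-𝟘 js)
  ∑-comm g (i ∷ is) js = trans (cong (∑ js (g i) ⊞_) (∑-comm g is js)) (sym (∑-⊞ (g i) _ js))

  linear-∑ : ∀ {m n} {M : Vec A m → Vec A n} → IsLinear M →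
             ∀ {I : Set} (g : I → Vec A m) is → M (∑ is g) ≡ ∑ is (M ∘ g)
  linear-∑ {M = M} M-linear g []       = IsLinear.preserves-𝟘 M-linear
  linear-∑ {M = M} M-linear g (i ∷ is) =
    trans (IsLinear.additive M-linear (g i) _) (cong (M (g i) ⊞_) (linear-∑ M-linear g is))

  linear-resp-≗ : ∀ {m n} {M N : Vec A m → Vec A n} → (∀ v → M v ≡ N v) → IsLinear N → IsLinear M
  linear-resp-≗ M≗N N-linear = record
    { additive    = λ u v → trans (M≗N (u ⊞ v)) (trans (additive u v) (sym (cong₂ _⊞_ (M≗N u) (M≗N v))))
    ; homogeneous = λ c v → trans (M≗N (c • v)) (trans (homogeneous c v) (cong (c •_) (sym (M≗N v))))
    }
    where open IsLinear N-linear

  •-linear : ∀ {n} c → IsLinear {n} (c •_)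
  •-linear c = record { additive = •-distribˡ c ; homogeneous = •-comm c }

  last-• : ∀ {n} c (v : Vec A (suc n)) → last (c • v) ≡ c *ᴬ last v
  last-• {zero}  c (x ∷ []) = refl
  last-• {suc n} c (x ∷ v)  = last-• c v

  init-• : ∀ {n} c (v : Vec A (suc n)) → init (c • v) ≡ c • init v
  init-• {zero}  c (x ∷ []) = refl
  init-• {suc n} c (x ∷ v)  = cong (_ ∷_) (init-• c v)

  mulX-linear : ∀ {n} (r : Vec A (suc n)) → IsLinear (mulX r)
  mulX-linear r = record { additive = additive ; homogeneous = homogeneous }
    where
    additive : ∀ u v → mulX r (u ⊞ v) ≡ mulX r u ⊞ mulX r v
    additive u v = begin
      (0ᴬ ∷ init (u ⊞ v)) ⊞ last (u ⊞ v) • r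
        ≡⟨ cong₂ _⊞_ (cong₂ _∷_ (sym (+-identityˡ 0ᴬ)) (init-⊞ u v))
                     (trans (cong (_• r) (last-⊞ u v)) (•-distribʳ (last u) (last v) r)) ⟩
      ((0ᴬ ∷ init u) ⊞ (0ᴬ ∷ init v)) ⊞ (last u • r ⊞ last v • r)
        ≡⟨ ⊞-interchange (0ᴬ ∷ init u) (0ᴬ ∷ init v) _ _ ⟩
      mulX r u ⊞ mulX r v ∎

    homogeneous : ∀ c v → mulX r (c • v) ≡ c • mulX r v
    homogeneous c v = begin
      (0ᴬ ∷ init (c • v)) ⊞ last (c • v) • r
        ≡⟨ cong₂ _⊞_ (cong₂ _∷_ (sym (zeroʳ c)) (init-• c v))
                     (trans (cong (_• r) (last-• c v)) (•-assoc c (last v) r)) ⟩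
      c • (0ᴬ ∷ init v) ⊞ c • last v • r
        ≡⟨ •-distribˡ c (0ᴬ ∷ init v) _ ⟨
      c • mulX r v ∎

  module Horner {n} {M : Vec A n → Vec A n} (M-linear : IsLinear M) where
    open IsLinear M-linear

    horner-linearʳ : ∀ {m} (u : Vec A m) → IsLinear (horner M u)
    horner-linearʳ u = record { additive = add u ; homogeneous = λ c → hom c u }
      where
      add : ∀ {m} (u : Vec A m) v w → horner M u (v ⊞ w) ≡ horner M u v ⊞ horner M u w
      add []      v w = sym (⊞-identityˡ 𝟘)
      add (c ∷ u) v w = begin
        c • (v ⊞ w) ⊞ M (horner M u (v ⊞ w))
          ≡⟨ cong₂ _⊞_ (•-distribˡ c v w) (trans (cong M (add u v w)) (additive _ _)) ⟩
        (c • v ⊞ c • w) ⊞ (M (horner M u v) ⊞ M (horner M u w))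
          ≡⟨ ⊞-interchange (c • v) (c • w) _ _ ⟩
        horner M (c ∷ u) v ⊞ horner M (c ∷ u) w ∎

      hom : ∀ {m} d (u : Vec A m) v → horner M u (d • v) ≡ d • horner M u v
      hom d []      v = sym (•-zeroʳ d n)
      hom d (c ∷ u) v = begin
        c • d • v ⊞ M (horner M u (d • v))
          ≡⟨ cong₂ _⊞_ (•-comm c d v) (trans (cong M (hom d u v)) (homogeneous d _)) ⟩
        d • c • v ⊞ d • M (horner M u v)
          ≡⟨ •-distribˡ d (c • v) _ ⟨
        d • horner M (c ∷ u) v ∎

    horner-linearˡ : ∀ {m} (v : Vec A n) → IsLinear {m} (λ u → horner M u v)
    horner-linearˡ v = record { additive = add ; homogeneous = hom }
      where
      add : ∀ {m} (u w : Vec A m) → horner M (u ⊞ w) v ≡ horner M u v ⊞ horner M w v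
      add []      []      = sym (⊞-identityˡ 𝟘)
      add (c ∷ u) (d ∷ w) = begin
        (c +ᴬ d) • v ⊞ M (horner M (u ⊞ w) v)
          ≡⟨ cong₂ _⊞_ (•-distribʳ c d v) (trans (cong M (add u w)) (additive _ _)) ⟩
        (c • v ⊞ d • v) ⊞ (M (horner M u v) ⊞ M (horner M w v))
          ≡⟨ ⊞-interchange (c • v) (d • v) _ _ ⟩
        horner M (c ∷ u) v ⊞ horner M (d ∷ w) v ∎

      hom : ∀ {m} d (u : Vec A m) → horner M (d • u) v ≡ d • horner M u v
      hom d []      = sym (•-zeroʳ d n)
      hom d (c ∷ u) = begin
        (d *ᴬ c) • v ⊞ M (horner M (d • u) v)
          ≡⟨ cong₂ _⊞_ (•-assoc d c v) (trans (cong M (hom d u)) (homogeneous d _)) ⟩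
        d • c • v ⊞ d • M (horner M u v)
          ≡⟨ •-distribˡ d (c • v) _ ⟨
        d • horner M (c ∷ u) v ∎

    -- Peels off the top coefficient, the one that `mulX` wraps around, whereas `horner` itself
    -- recurses from the bottom.
    horner-init-last : ∀ {m} (u : Vec A (suc m)) v →
                       horner M u v ≡ horner M (init u) v ⊞ last u • iterate M m v
    horner-init-last {zero}  (c ∷ []) v = begin
      c • v ⊞ M 𝟘 ≡⟨ cong (c • v ⊞_) preserves-𝟘 ⟩
      c • v ⊞ 𝟘   ≡⟨ ⊞-identityʳ _ ⟩
      c • v       ≡⟨ ⊞-identityˡ _ ⟨
      𝟘 ⊞ c • v   ∎
    horner-init-last {suc m} (c ∷ u)  v = begin
      c • v ⊞ M (horner M u v)
        ≡⟨ cong (c • v ⊞_) (trans (cong M (horner-init-last u v)) (additive _ _)) ⟩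
      c • v ⊞ (M (horner M (init u) v) ⊞ M (last u • iterate M m v))
        ≡⟨ cong (λ w → c • v ⊞ (M (horner M (init u) v) ⊞ w)) (homogeneous (last u) _) ⟩
      c • v ⊞ (M (horner M (init u) v) ⊞ last u • iterate M (suc m) v)
        ≡⟨ ⊞-assoc (c • v) _ _ ⟨
      horner M (c ∷ init u) v ⊞ last u • iterate M (suc m) v ∎

    -- Evaluation X ↦ `M` respects the quotient by X^(m+1) - `r` as soon as `M` satisfies that
    -- relation on `v`.
    horner-mulX : ∀ {m} (r : Vec A (suc m)) v → horner M r v ≡ iterate M (suc m) v →
                  ∀ u → horner M (mulX r u) v ≡ M (horner M u v)
    horner-mulX {m} r v r-relation u = begin
      horner M ((0ᴬ ∷ init u) ⊞ last u • r) v
        ≡⟨ IsLinear.additive (horner-linearˡ v) (0ᴬ ∷ init u) (last u • r) ⟩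
      (0ᴬ • v ⊞ M (horner M (init u) v)) ⊞ horner M (last u • r) v
        ≡⟨ cong₂ _⊞_ (trans (cong (_⊞ M (horner M (init u) v)) (•-zeroˡ v)) (⊞-identityˡ _))
                     (trans (IsLinear.homogeneous (horner-linearˡ v) (last u) r) (cong (last u •_) r-relation)) ⟩
      M (horner M (init u) v) ⊞ last u • M (iterate M m v)
        ≡⟨ cong (M (horner M (init u) v) ⊞_) (homogeneous (last u) _) ⟨
      M (horner M (init u) v) ⊞ M (last u • iterate M m v)
        ≡⟨ additive _ _ ⟨
      M (horner M (init u) v ⊞ last u • iterate M m v)
        ≡⟨ cong M (horner-init-last u v) ⟨
      M (horner M u v) ∎

module ℤⁿ = Coefficients ℤ.+-*-isCommutativeSemiring
module 𝔽₂ⁿ = Coefficients (CommutativeRing.isCommutativeSemiring Bool.xor-∧-commutativeRing)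

open 𝔽₂ⁿ using (_⊞_; _•_; 𝟘; ∑; horner; iterate; IsLinear; linear-resp-≗)

-- Reduction modulo 2

odd : ℕ → Bool
odd zero    = false
odd (suc n) = not (odd n)

odd-+ : ∀ m n → odd (m + n) ≡ odd m xor odd n
odd-+ zero    n = refl
odd-+ (suc m) n = trans (cong not (odd-+ m n)) (Bool.not-distribˡ-xor (odd m) (odd n))

odd-* : ∀ m n → odd (m * n) ≡ odd m ∧ odd n
odd-* zero    n = refl
odd-* (suc m) n = begin
  odd (n + m * n)            ≡⟨ odd-+ n (m * n) ⟩
  odd n xor odd (m * n)      ≡⟨ cong (odd n xor_) (odd-* m n) ⟩
  odd n xor (odd m ∧ odd n)  ≡⟨ xor-∧ (odd m) (odd n) ⟩
  not (odd m) ∧ odd n        ∎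
  where
  xor-∧ : ∀ a b → b xor (a ∧ b) ≡ not a ∧ b
  xor-∧ false b = Bool.xor-identityʳ b
  xor-∧ true  b = Bool.xor-same b

parity : ℤ → Bool
parity i = odd ∣ i ∣

parity-⊖ : ∀ m n → parity (m ⊖ n) ≡ odd m xor odd n
parity-⊖ zero    zero    = refl
parity-⊖ zero    (suc n) = refl
parity-⊖ (suc m) zero    = sym (Bool.xor-identityʳ (odd (suc m)))
parity-⊖ (suc m) (suc n) = begin
  parity (suc m ⊖ suc n)       ≡⟨ cong parity (ℤ.[1+m]⊖[1+n]≡m⊖n m n) ⟩
  parity (m ⊖ n)               ≡⟨ parity-⊖ m n ⟩
  odd m xor odd n              ≡⟨ not-xor-not (odd m) (odd n) ⟨
  not (odd m) xor not (odd n)  ∎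
  where
  not-xor-not : ∀ a b → not a xor not b ≡ a xor b
  not-xor-not false b = Bool.not-involutive b
  not-xor-not true  b = refl

parity-+ : ∀ i j → parity (i ℤ.+ j) ≡ parity i xor parity j
parity-+ (+ m)      (+ n)      = odd-+ m n
parity-+ (+ m)      -[1+ n ]   = parity-⊖ m (suc n)
parity-+ -[1+ m ]   (+ n)      = trans (parity-⊖ n (suc m)) (Bool.xor-comm (odd n) _)
parity-+ -[1+ m ]   -[1+ n ]   = trans (cong (odd ∘ suc) (sym (ℕ.+-suc m n))) (odd-+ (suc m) (suc n))

parity-* : ∀ i j → parity (i ℤ.* j) ≡ parity i ∧ parity j
parity-* i j = trans (cong odd (ℤ.abs-* i j)) (odd-* ∣ i ∣ ∣ j ∣)

even⇒double : ∀ i → parity i ≡ false → ∃ λ j → i ≡ + 2 ℤ.* j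
even⇒double (+ n) n-even with halve n n-even
  where
  halve : ∀ n → odd n ≡ false → ∃ λ m → n ≡ 2 * m
  halve zero          _ = 0 , refl
  halve (suc (suc n)) p with halve n (trans (sym (Bool.not-involutive (odd n))) p)
  ... | m , refl = suc m , sym (ℕ.*-suc 2 m)
... | m , refl = + m , ℤ.pos-* 2 m
even⇒double -[1+ n ] n-even with even⇒double (+ suc n) n-even
... | j , eq = ℤ.- j , trans (cong ℤ.-_ eq) (ℤ.neg-distribʳ-* (+ 2) j)

mod2 : ∀ {n} → Vec ℤ n → Vec Bool n
mod2 = map parity

mod2-⊞ : ∀ {n} (u v : Vec ℤ n) → mod2 (u ℤⁿ.⊞ v) ≡ mod2 u ⊞ mod2 v
mod2-⊞ []      []      = refl
mod2-⊞ (x ∷ u) (y ∷ v) = cong₂ _∷_ (parity-+ x y) (mod2-⊞ u v)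

mod2-• : ∀ {n} c (v : Vec ℤ n) → mod2 (c ℤⁿ.• v) ≡ parity c • mod2 v
mod2-• c []      = refl
mod2-• c (x ∷ v) = cong₂ _∷_ (parity-* c x) (mod2-• c v)

mod2-init : ∀ {n} (v : Vec ℤ (suc n)) → mod2 (init v) ≡ init (mod2 v)
mod2-init {zero}  (x ∷ []) = refl
mod2-init {suc n} (x ∷ v)  = cong (_ ∷_) (mod2-init v)

mod2-last : ∀ {n} (v : Vec ℤ (suc n)) → parity (last v) ≡ last (mod2 v)
mod2-last {zero}  (x ∷ []) = refl
mod2-last {suc n} (x ∷ v)  = mod2-last v

mod2-mulX : ∀ {n} (r v : Vec ℤ (suc n)) → mod2 (ℤⁿ.mulX r v) ≡ 𝔽₂ⁿ.mulX (mod2 r) (mod2 v)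
mod2-mulX r v = begin
  mod2 (ℤⁿ.mulX r v)
    ≡⟨ mod2-⊞ (+ 0 ∷ init v) _ ⟩
  (false ∷ mod2 (init v)) ⊞ mod2 (last v ℤⁿ.• r)
    ≡⟨ cong₂ _⊞_ (cong (false ∷_) (mod2-init v))
                 (trans (mod2-• (last v) r) (cong (_• mod2 r) (mod2-last v))) ⟩
  𝔽₂ⁿ.mulX (mod2 r) (mod2 v) ∎

mod2-𝟘⇒double : ∀ {n} (v : Vec ℤ n) → mod2 v ≡ 𝟘 → ∃ λ w → v ≡ + 2 ℤⁿ.• w
mod2-𝟘⇒double []      _ = [] , refl
mod2-𝟘⇒double (x ∷ v) p with even⇒double x (Vec.∷-injectiveˡ p) | mod2-𝟘⇒double v (Vec.∷-injectiveʳ p)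
... | y , refl | w , refl = y ∷ w , refl

double-injective : ∀ {n} (v w : Vec ℤ n) → + 2 ℤⁿ.• v ≡ + 2 ℤⁿ.• w → v ≡ w
double-injective []      []      _ = refl
double-injective (x ∷ v) (y ∷ w) p =
  cong₂ _∷_ (ℤ.*-cancelˡ-≡ (+ 2) x y (Vec.∷-injectiveˡ p)) (double-injective v w (Vec.∷-injectiveʳ p))

-- The residue field 𝔽₆₄

-- The finite facts about 𝔽₆₄ are settled by exhaustion over bit vectors, with at most 4096 cases
-- each.
allVec? : ∀ {n} {P : Vec Bool n → Set} → (∀ v → Dec (P v)) → Dec (∀ v → P v)
allVec? {zero}  P? = map′ (λ { p [] → p }) (λ p → p []) (P? [])
allVec? {suc n} P? =
  map′ (λ { (p , q) (false ∷ v) → p v ; (p , q) (true ∷ v) → q v })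
       (λ p → p ∘ (false ∷_) , p ∘ (true ∷_))
       (allVec? (P? ∘ (false ∷_)) ×-dec allVec? (P? ∘ (true ∷_)))

_≟ᵛ_ : ∀ {n} (u v : Vec Bool n) → Dec (u ≡ v)
_≟ᵛ_ = Vec.≡-dec Bool._≟_

⊞-self : ∀ {n} (v : Vec Bool n) → v ⊞ v ≡ 𝟘
⊞-self []      = refl
⊞-self (x ∷ v) = cong₂ _∷_ (Bool.xor-same x) (⊞-self v)

⊞≡𝟘⇒≡ : ∀ {n} (u v : Vec Bool n) → u ⊞ v ≡ 𝟘 → u ≡ v
⊞≡𝟘⇒≡ u v u+v≡0 = begin
  u             ≡⟨ 𝔽₂ⁿ.⊞-identityʳ u ⟨
  u ⊞ 𝟘         ≡⟨ cong (u ⊞_) (⊞-self v) ⟨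
  u ⊞ (v ⊞ v)   ≡⟨ 𝔽₂ⁿ.⊞-assoc u v v ⟨
  (u ⊞ v) ⊞ v   ≡⟨ cong (_⊞ v) u+v≡0 ⟩
  𝟘 ⊞ v         ≡⟨ 𝔽₂ⁿ.⊞-identityˡ v ⟩
  v             ∎

-- 𝔽₆₄ = 𝔽₂[θ] with θ⁶ = θ⁴ + θ² + θ + 1, one of the two irreducible factors of Φ₄₂ modulo 2
-- (the other one has the root θ⁻¹).
𝔽₆₄ : Set
𝔽₆₄ = Vec Bool 6

𝟙 : 𝔽₆₄
𝟙 = true ∷ 𝟘

θ· : 𝔽₆₄ → 𝔽₆₄
θ· (a ∷ b ∷ c ∷ d ∷ e ∷ f ∷ []) = f ∷ (a xor f) ∷ (b xor f) ∷ c ∷ (d xor f) ∷ e ∷ []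

-- Dividing the relation for θ⁶ by θ gives θ⁻¹ = 1 + θ + θ³ + θ⁵, so `a` is added at the positions
-- 0, 1, 3, 5.
θ⁻¹· : 𝔽₆₄ → 𝔽₆₄
θ⁻¹· (a ∷ b ∷ c ∷ d ∷ e ∷ f ∷ []) = (b xor a) ∷ (c xor a) ∷ d ∷ (e xor a) ∷ f ∷ a ∷ []

θ⁶ : 𝔽₆₄
θ⁶ = iterate θ· 6 𝟙

infixl 7 _·_
_·_ : 𝔽₆₄ → 𝔽₆₄ → 𝔽₆₄
_·_ = horner θ·

θ·≡mulX : ∀ p → θ· p ≡ 𝔽₂ⁿ.mulX θ⁶ p
θ·≡mulX = toWitness {a? = allVec? λ p → θ· p ≟ᵛ 𝔽₂ⁿ.mulX θ⁶ p} tt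

θ·-linear : IsLinear θ·
θ·-linear = linear-resp-≗ θ·≡mulX (𝔽₂ⁿ.mulX-linear θ⁶)

module Hθ = 𝔽₂ⁿ.Horner θ·-linear

·-linearˡ : ∀ q → IsLinear (_· q)
·-linearˡ = Hθ.horner-linearˡ

·-linearʳ : ∀ p → IsLinear (p ·_)
·-linearʳ = Hθ.horner-linearʳ

·-zeroˡ : ∀ q → 𝟘 · q ≡ 𝟘
·-zeroˡ q = IsLinear.preserves-𝟘 (·-linearˡ q)

·-zeroʳ : ∀ p → p · 𝟘 ≡ 𝟘
·-zeroʳ p = IsLinear.preserves-𝟘 (·-linearʳ p)

·-identityˡ : ∀ q → 𝟙 · q ≡ q
·-identityˡ = toWitness {a? = allVec? λ q → (𝟙 · q) ≟ᵛ q} tt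

-- The instance of associativity behind the law of exponents and the multiplicativity of `φ`.
θ·-· : ∀ p q → θ· p · q ≡ θ· (p · q)
θ·-· p q = trans (cong (_· q) (θ·≡mulX p)) (Hθ.horner-mulX θ⁶ q (θ⁶-relation q) p)
  where
  θ⁶-relation : ∀ q → θ⁶ · q ≡ iterate θ· 6 q
  θ⁶-relation = toWitness {a? = allVec? λ q → (θ⁶ · q) ≟ᵛ iterate θ· 6 q} tt

-- This makes the kernel Q of `φ` a prime ideal.
·-integral : ∀ p q → p · q ≡ 𝟘 → p ≡ 𝟘 ⊎ q ≡ 𝟘
·-integral = toWitness {a? = allVec? λ p → allVec? λ q → ((p · q) ≟ᵛ 𝟘) →-dec ((p ≟ᵛ 𝟘) ⊎-dec (q ≟ᵛ 𝟘))} tt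

-- Evaluating at θ and applying the result to `q` is multiplication by the value at θ. The length 12
-- is what makes `φ` multiplicative.
horner≡· : ∀ {m} (u : Vec Bool m) q → horner θ· u q ≡ horner θ· u 𝟙 · q
horner≡· []      q = sym (·-zeroˡ q)
horner≡· (c ∷ u) q = begin
  c • q ⊞ θ· (horner θ· u q)              ≡⟨ cong₂ _⊞_ (cong (c •_) (sym (·-identityˡ q))) (cong θ· (horner≡· u q)) ⟩
  c • (𝟙 · q) ⊞ θ· (horner θ· u 𝟙 · q)    ≡⟨ cong₂ _⊞_ (sym (IsLinear.homogeneous (·-linearˡ q) c 𝟙)) (sym (θ·-· (horner θ· u 𝟙) q)) ⟩
  (c • 𝟙) · q ⊞ θ· (horner θ· u 𝟙) · q    ≡⟨ IsLinear.additive (·-linearˡ q) (c • 𝟙) (θ· (horner θ· u 𝟙)) ⟨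
  horner θ· (c ∷ u) 𝟙 · q                 ∎

-- Opaque, because unfolding θ^ at large exponents makes conversion checking exponential.
opaque
  θ^ : ℕ → 𝔽₆₄
  θ^ k = iterate θ· k 𝟙

  θ^-zero : θ^ 0 ≡ 𝟙
  θ^-zero = refl

  θ^-suc : ∀ k → θ^ (suc k) ≡ θ· (θ^ k)
  θ^-suc k = refl

  θ⁴²≡𝟙 : θ^ 42 ≡ 𝟙
  θ⁴²≡𝟙 = toWitness {a? = θ^ 42 ≟ᵛ 𝟙} tt

  -- Matches the exponents `41 * k` by which conjugates of powers of ζ are written.
  θ⁻¹·≡θ⁴¹ : ∀ p → θ⁻¹· p ≡ θ^ 41 · p
  θ⁻¹·≡θ⁴¹ = toWitness {a? = allVec? λ p → θ⁻¹· p ≟ᵛ (θ^ 41 · p)} tt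

θ^-+ : ∀ j k → θ^ (j + k) ≡ θ^ j · θ^ k
θ^-+ zero    k = sym (trans (cong (_· θ^ k) θ^-zero) (·-identityˡ (θ^ k)))
θ^-+ (suc j) k = begin
  θ^ (suc (j + k))     ≡⟨ θ^-suc (j + k) ⟩
  θ· (θ^ (j + k))      ≡⟨ cong θ· (θ^-+ j k) ⟩
  θ· (θ^ j · θ^ k)     ≡⟨ θ·-· (θ^ j) (θ^ k) ⟨
  θ· (θ^ j) · θ^ k     ≡⟨ cong (_· θ^ k) (θ^-suc j) ⟨
  θ^ (suc j) · θ^ k    ∎

θ^-*42 : ∀ m → θ^ (m * 42) ≡ 𝟙
θ^-*42 zero    = θ^-zero
θ^-*42 (suc m) = begin
  θ^ (42 + m * 42)    ≡⟨ θ^-+ 42 (m * 42) ⟩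
  θ^ 42 · θ^ (m * 42) ≡⟨ cong (_· θ^ (m * 42)) θ⁴²≡𝟙 ⟩
  𝟙 · θ^ (m * 42)     ≡⟨ ·-identityˡ (θ^ (m * 42)) ⟩
  θ^ (m * 42)         ≡⟨ θ^-*42 m ⟩
  𝟙                   ∎

θ^-%42 : ∀ k → θ^ k ≡ θ^ (k % 42)
θ^-%42 k = begin
  θ^ k                                ≡⟨ cong θ^ (m≡m%n+[m/n]*n k 42) ⟩
  θ^ (k % 42 + (k / 42) * 42)         ≡⟨ cong θ^ (ℕ.+-comm (k % 42) _) ⟩
  θ^ ((k / 42) * 42 + k % 42)         ≡⟨ θ^-+ ((k / 42) * 42) (k % 42) ⟩
  θ^ ((k / 42) * 42) · θ^ (k % 42)    ≡⟨ cong (_· θ^ (k % 42)) (θ^-*42 (k / 42)) ⟩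
  𝟙 · θ^ (k % 42)                     ≡⟨ ·-identityˡ (θ^ (k % 42)) ⟩
  θ^ (k % 42)                         ∎

θ⁻¹·-linear : IsLinear θ⁻¹·
θ⁻¹·-linear = linear-resp-≗ θ⁻¹·≡θ⁴¹ (·-linearʳ (θ^ 41))

module Hθ⁻¹ = 𝔽₂ⁿ.Horner θ⁻¹·-linear

-- The two residue maps ℤ[ζ] → 𝔽₆₄, ζ ↦ θ and ζ ↦ θ⁻¹

φ φ̄ : Cyc → 𝔽₆₄
φ v = horner θ· (mod2 v) 𝟙
φ̄ v = horner θ⁻¹· (mod2 v) 𝟙

φ-⊕ : ∀ u v → φ (u ⊕ v) ≡ φ u ⊞ φ v
φ-⊕ u v = trans (cong (λ w → horner θ· w 𝟙) (mod2-⊞ u v)) (IsLinear.additive (Hθ.horner-linearˡ 𝟙) (mod2 u) (mod2 v))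

φ̄-⊕ : ∀ u v → φ̄ (u ⊕ v) ≡ φ̄ u ⊞ φ̄ v
φ̄-⊕ u v = trans (cong (λ w → horner θ⁻¹· w 𝟙) (mod2-⊞ u v)) (IsLinear.additive (Hθ⁻¹.horner-linearˡ 𝟙) (mod2 u) (mod2 v))

φ-scale : ∀ c v → φ (scale c v) ≡ parity c • φ v
φ-scale c v = trans (cong (λ w → horner θ· w 𝟙) (mod2-• c v)) (IsLinear.homogeneous (Hθ.horner-linearˡ 𝟙) (parity c) (mod2 v))

-- The `refl` evaluates both sides of Φ₄₂(θ) = 0, in the form that the reduced `ζ¹²` takes the value
-- θ^12.
φ-mulζ : ∀ v → φ (mulζ v) ≡ θ· (φ v)
φ-mulζ v = trans (cong (λ w → horner θ· w 𝟙) (mod2-mulX ζ¹² v)) (Hθ.horner-mulX (mod2 ζ¹²) 𝟙 refl (mod2 v))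

φ̄-mulζ : ∀ v → φ̄ (mulζ v) ≡ θ⁻¹· (φ̄ v)
φ̄-mulζ v = trans (cong (λ w → horner θ⁻¹· w 𝟙) (mod2-mulX ζ¹² v)) (Hθ⁻¹.horner-mulX (mod2 ζ¹²) 𝟙 refl (mod2 v))

φ-⊗ : ∀ u v → φ (u ⊗ v) ≡ φ u · φ v
φ-⊗ u v = trans (φ-horner u) (horner≡· (mod2 u) (φ v))
  where
  φ-horner : ∀ {m} (u : Vec ℤ m) → φ (ℤⁿ.horner mulζ u v) ≡ horner θ· (mod2 u) (φ v)
  φ-horner []      = refl
  φ-horner (c ∷ u) = begin
    φ (scale c v ⊕ mulζ (ℤⁿ.horner mulζ u v))
      ≡⟨ φ-⊕ (scale c v) (mulζ (ℤⁿ.horner mulζ u v)) ⟩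
    φ (scale c v) ⊞ φ (mulζ (ℤⁿ.horner mulζ u v))
      ≡⟨ cong₂ _⊞_ (φ-scale c v) (trans (φ-mulζ (ℤⁿ.horner mulζ u v)) (cong θ· (φ-horner u))) ⟩
    horner θ· (mod2 (c ∷ u)) (φ v) ∎

φ-ζ^ : ∀ k → φ (ζ^ k) ≡ θ^ k
φ-ζ^ zero    = sym θ^-zero
φ-ζ^ (suc k) = trans (φ-mulζ (ζ^ k)) (trans (cong θ· (φ-ζ^ k)) (sym (θ^-suc k)))

φ̄-ζ^ : ∀ k → φ̄ (ζ^ k) ≡ θ^ (41 * k)
φ̄-ζ^ zero    = sym θ^-zero
φ̄-ζ^ (suc k) = begin
  φ̄ (mulζ (ζ^ k))         ≡⟨ φ̄-mulζ (ζ^ k) ⟩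
  θ⁻¹· (φ̄ (ζ^ k))         ≡⟨ cong θ⁻¹· (φ̄-ζ^ k) ⟩
  θ⁻¹· (θ^ (41 * k))      ≡⟨ θ⁻¹·≡θ⁴¹ (θ^ (41 * k)) ⟩
  θ^ 41 · θ^ (41 * k)     ≡⟨ θ^-+ 41 (41 * k) ⟨
  θ^ (41 + 41 * k)        ≡⟨ cong θ^ (ℕ.*-suc 41 k) ⟨
  θ^ (41 * suc k)         ∎

-- The Chinese remainder theorem modulo 2: the two factors of Φ₄₂ are coprime, so a residue vector
-- killed at both θ and θ⁻¹ is zero.
kernels-meet-in-2 : ∀ v → φ v ≡ 𝟘 → φ̄ v ≡ 𝟘 → ∃ λ w → v ≡ scale (+ 2) w
kernels-meet-in-2 v φv≡0 φ̄v≡0 = mod2-𝟘⇒double v (kernel (mod2 v) φv≡0 φ̄v≡0)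
  where
  kernel : ∀ (b : Vec Bool 12) → horner θ· b 𝟙 ≡ 𝟘 → horner θ⁻¹· b 𝟙 ≡ 𝟘 → b ≡ 𝟘
  kernel = toWitness {a? = allVec? λ b → (horner θ· b 𝟙 ≟ᵛ 𝟘) →-dec ((horner θ⁻¹· b 𝟙 ≟ᵛ 𝟘) →-dec (b ≟ᵛ 𝟘))} tt

-- Splitting the exponential sums by the parity of x

⊗-linearˡ : ∀ v → ℤⁿ.IsLinear (_⊗ v)
⊗-linearˡ = ℤⁿ.Horner.horner-linearˡ (ℤⁿ.mulX-linear ζ¹²)

⊗-linearʳ : ∀ u → ℤⁿ.IsLinear (u ⊗_)
⊗-linearʳ = ℤⁿ.Horner.horner-linearʳ (ℤⁿ.mulX-linear ζ¹²)

⊕⊗⊕ : ∀ a b c d → (a ⊕ b) ⊗ (c ⊕ d) ≡ ((a ⊗ c) ⊕ (a ⊗ d)) ⊕ ((b ⊗ c) ⊕ (b ⊗ d))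
⊕⊗⊕ a b c d = begin
  (a ⊕ b) ⊗ (c ⊕ d)
    ≡⟨ ℤⁿ.IsLinear.additive (⊗-linearˡ (c ⊕ d)) a b ⟩
  (a ⊗ (c ⊕ d)) ⊕ (b ⊗ (c ⊕ d))
    ≡⟨ cong₂ _⊕_ (ℤⁿ.IsLinear.additive (⊗-linearʳ a) c d) (ℤⁿ.IsLinear.additive (⊗-linearʳ b) c d) ⟩
  ((a ⊗ c) ⊕ (a ⊗ d)) ⊕ ((b ⊗ c) ⊕ (b ⊗ d)) ∎

⊖_ : Cyc → Cyc
⊖_ = scale -[1+ 0 ]

⊖⊗ : ∀ u v → (⊖ u) ⊗ v ≡ ⊖ (u ⊗ v)
⊖⊗ u v = ℤⁿ.IsLinear.homogeneous (⊗-linearˡ v) -[1+ 0 ] u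

⊗⊖ : ∀ u v → u ⊗ (⊖ v) ≡ ⊖ (u ⊗ v)
⊗⊖ u v = ℤⁿ.IsLinear.homogeneous (⊗-linearʳ u) -[1+ 0 ] v

-- Kept over ℤ with its factor 2 explicit, so that the factor can be cancelled; modulo 2 both sides
-- vanish.
parallelogram : ∀ a b c d →
                ((a ⊕ b) ⊗ (c ⊕ d)) ⊕ ((a ⊕ (⊖ b)) ⊗ (c ⊕ (⊖ d))) ≡ scale (+ 2) ((a ⊗ c) ⊕ (b ⊗ d))
parallelogram a b c d = begin
  ((a ⊕ b) ⊗ (c ⊕ d)) ⊕ ((a ⊕ (⊖ b)) ⊗ (c ⊕ (⊖ d)))
    ≡⟨ cong₂ _⊕_ (⊕⊗⊕ a b c d) (⊕⊗⊕ a (⊖ b) c (⊖ d)) ⟩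
  (((a ⊗ c) ⊕ (a ⊗ d)) ⊕ ((b ⊗ c) ⊕ (b ⊗ d))) ⊕ (((a ⊗ c) ⊕ (a ⊗ (⊖ d))) ⊕ (((⊖ b) ⊗ c) ⊕ ((⊖ b) ⊗ (⊖ d))))
    ≡⟨ cong ((((a ⊗ c) ⊕ (a ⊗ d)) ⊕ ((b ⊗ c) ⊕ (b ⊗ d))) ⊕_)
            (cong₂ _⊕_ (cong ((a ⊗ c) ⊕_) (⊗⊖ a d))
                       (cong₂ _⊕_ (⊖⊗ b c) (trans (⊖⊗ b (⊖ d)) (cong ⊖_ (⊗⊖ b d))))) ⟩
  (((a ⊗ c) ⊕ (a ⊗ d)) ⊕ ((b ⊗ c) ⊕ (b ⊗ d))) ⊕ (((a ⊗ c) ⊕ (⊖ (a ⊗ d))) ⊕ ((⊖ (b ⊗ c)) ⊕ (⊖ (⊖ (b ⊗ d)))))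
    ≡⟨ cancel (a ⊗ c) (a ⊗ d) (b ⊗ c) (b ⊗ d) ⟩
  scale (+ 2) ((a ⊗ c) ⊕ (b ⊗ d)) ∎
  where
  cancel-ℤ : ∀ p q r s →
             ((p ℤ.+ q) ℤ.+ (r ℤ.+ s)) ℤ.+
             ((p ℤ.+ -[1+ 0 ] ℤ.* q) ℤ.+ (-[1+ 0 ] ℤ.* r ℤ.+ -[1+ 0 ] ℤ.* (-[1+ 0 ] ℤ.* s)))
             ≡ + 2 ℤ.* (p ℤ.+ s)
  cancel-ℤ = ℤ-Solver.solve-∀

  cancel : ∀ {n} (p q r s : Vec ℤ n) →
           ((p ℤⁿ.⊞ q) ℤⁿ.⊞ (r ℤⁿ.⊞ s)) ℤⁿ.⊞
           ((p ℤⁿ.⊞ -[1+ 0 ] ℤⁿ.• q) ℤⁿ.⊞ (-[1+ 0 ] ℤⁿ.• r ℤⁿ.⊞ -[1+ 0 ] ℤⁿ.• -[1+ 0 ] ℤⁿ.• s))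
           ≡ + 2 ℤⁿ.• (p ℤⁿ.⊞ s)
  cancel []      []      []      []      = refl
  cancel (w ∷ p) (x ∷ q) (y ∷ r) (z ∷ s) = cong₂ _∷_ (cancel-ℤ w x y z) (cancel p q r s)

ζ^-+21 : ∀ k → ζ^ (k + 21) ≡ ⊖ (ζ^ k)
ζ^-+21 zero    = toWitness {a? = Vec.≡-dec ℤ._≟_ (ζ^ 21) (⊖ oneC)} tt
ζ^-+21 (suc k) = trans (cong mulζ (ζ^-+21 k)) (ℤⁿ.IsLinear.homogeneous (ℤⁿ.mulX-linear ζ¹²) -[1+ 0 ] (ζ^ k))

-- Serves twice: with `m` even it gives the period 42, with `m` of the parity of x it gives the sign
-- (-1)^x.
ζ^-+*21 : ∀ m k → ζ^ (k + m * 21) ≡ (if odd m then ⊖ (ζ^ k) else ζ^ k)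
ζ^-+*21 zero    k = cong ζ^ (ℕ.+-identityʳ k)
ζ^-+*21 (suc m) k = begin
  ζ^ (k + (21 + m * 21))                      ≡⟨ cong ζ^ (rearrange k (m * 21)) ⟩
  ζ^ ((k + m * 21) + 21)                      ≡⟨ ζ^-+21 (k + m * 21) ⟩
  ⊖ (ζ^ (k + m * 21))                         ≡⟨ cong ⊖_ (ζ^-+*21 m k) ⟩
  ⊖ (if odd m then ⊖ (ζ^ k) else ζ^ k)        ≡⟨ flip (odd m) ⟩
  (if not (odd m) then ⊖ (ζ^ k) else ζ^ k)    ∎
  where
  rearrange : ∀ k n → k + (21 + n) ≡ (k + n) + 21
  rearrange = solve-∀

  flip : ∀ b → ⊖ (if b then ⊖ (ζ^ k) else ζ^ k) ≡ (if not b then ⊖ (ζ^ k) else ζ^ k)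
  flip false = refl
  flip true  = trans (sym (ℤⁿ.•-assoc -[1+ 0 ] -[1+ 0 ] (ζ^ k))) (ℤⁿ.•-identity (ζ^ k))

ζpow≡ζ^ : ∀ k → ζpow k ≡ ζ^ k
ζpow≡ζ^ k = sym (begin
  ζ^ k                                                                  ≡⟨ cong ζ^ (m≡m%n+[m/n]*n k 42) ⟩
  ζ^ (k % 42 + k / 42 * 42)                                             ≡⟨ cong (λ m → ζ^ (k % 42 + m)) (ℕ.*-assoc (k / 42) 2 21) ⟨
  ζ^ (k % 42 + k / 42 * 2 * 21)                                         ≡⟨ ζ^-+*21 (k / 42 * 2) (k % 42) ⟩
  (if odd (k / 42 * 2) then ⊖ (ζ^ (k % 42)) else ζ^ (k % 42))           ≡⟨ cong (λ b → if b then ⊖ (ζ^ (k % 42)) else ζ^ (k % 42))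
                                                                                (trans (odd-* (k / 42) 2) (Bool.∧-zeroʳ (odd (k / 42)))) ⟩
  ζ^ (k % 42)                                                           ∎)

-- Both halves stay sums over all residues, padded with zeros, so that splitting is a termwise
-- identity without reindexing.
evenTerm oddTerm : (Fin 42 → ℕ) → Fin 42 → Cyc
evenTerm k x = if odd (toℕ x) then zeroC else ζ^ (k x)
oddTerm  k x = if odd (toℕ x) then ζ^ (k x) else zeroC

∑-split : ∀ k is → ℤⁿ.∑ is (ζpow ∘ k) ≡ ℤⁿ.∑ is (evenTerm k) ⊕ ℤⁿ.∑ is (oddTerm k)
∑-split k is = trans (ℤⁿ.∑-cong pointwise is) (ℤⁿ.∑-⊞ (evenTerm k) (oddTerm k) is)
  where
  split : ∀ b (v : Cyc) → v ≡ (if b then zeroC else v) ⊕ (if b then v else zeroC)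
  split false v = sym (ℤⁿ.⊞-identityʳ v)
  split true  v = sym (ℤⁿ.⊞-identityˡ v)

  pointwise : ∀ x → ζpow (k x) ≡ evenTerm k x ⊕ oddTerm k x
  pointwise x = trans (ζpow≡ζ^ (k x)) (split (odd (toℕ x)) (ζ^ (k x)))

-- Here `k′` is the exponent after l is replaced by l + 21, for the sum as well as for its
-- conjugate.
∑-split-shifted : ∀ k k′ (m : Fin 42 → ℕ) → (∀ x → k′ x ≡ k x + m x * 21) → (∀ x → odd (m x) ≡ odd (toℕ x)) →
                  ∀ is → ℤⁿ.∑ is (ζpow ∘ k′) ≡ ℤⁿ.∑ is (evenTerm k) ⊕ (⊖ ℤⁿ.∑ is (oddTerm k))
∑-split-shifted k k′ m k′≡ m-parity is = begin
  ℤⁿ.∑ is (ζpow ∘ k′)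
    ≡⟨ ℤⁿ.∑-cong pointwise is ⟩
  ℤⁿ.∑ is (λ x → evenTerm k x ⊕ (⊖ oddTerm k x))
    ≡⟨ ℤⁿ.∑-⊞ (evenTerm k) (λ x → ⊖ oddTerm k x) is ⟩
  ℤⁿ.∑ is (evenTerm k) ⊕ ℤⁿ.∑ is (λ x → ⊖ oddTerm k x)
    ≡⟨ cong (ℤⁿ.∑ is (evenTerm k) ⊕_) (ℤⁿ.linear-∑ (ℤⁿ.•-linear -[1+ 0 ]) (oddTerm k) is) ⟨
  ℤⁿ.∑ is (evenTerm k) ⊕ (⊖ ℤⁿ.∑ is (oddTerm k)) ∎
  where
  split : ∀ b (v : Cyc) → (if b then ⊖ v else v) ≡ (if b then zeroC else v) ⊕ (⊖ (if b then v else zeroC))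
  split false v = sym (ℤⁿ.⊞-identityʳ v)
  split true  v = sym (ℤⁿ.⊞-identityˡ (⊖ v))

  pointwise : ∀ x → ζpow (k′ x) ≡ evenTerm k x ⊕ (⊖ oddTerm k x)
  pointwise x = begin
    ζpow (k′ x)                                        ≡⟨ ζpow≡ζ^ (k′ x) ⟩
    ζ^ (k′ x)                                          ≡⟨ cong ζ^ (k′≡ x) ⟩
    ζ^ (k x + m x * 21)                                ≡⟨ ζ^-+*21 (m x) (k x) ⟩
    (if odd (m x) then ⊖ (ζ^ (k x)) else ζ^ (k x))     ≡⟨ cong (λ b → if b then ⊖ (ζ^ (k x)) else ζ^ (k x)) (m-parity x) ⟩
    (if odd (toℕ x) then ⊖ (ζ^ (k x)) else ζ^ (k x))   ≡⟨ split (odd (toℕ x)) (ζ^ (k x)) ⟩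
    evenTerm k x ⊕ (⊖ oddTerm k x)                     ∎

φ-∑ : ∀ {I : Set} (g : I → Cyc) is → φ (ℤⁿ.∑ is g) ≡ ∑ is (φ ∘ g)
φ-∑ g []       = refl
φ-∑ g (i ∷ is) = trans (φ-⊕ (g i) (ℤⁿ.∑ is g)) (cong (φ (g i) ⊞_) (φ-∑ g is))

φ̄-∑ : ∀ {I : Set} (g : I → Cyc) is → φ̄ (ℤⁿ.∑ is g) ≡ ∑ is (φ̄ ∘ g)
φ̄-∑ g []       = refl
φ̄-∑ g (i ∷ is) = trans (φ̄-⊕ (g i) (ℤⁿ.∑ is g)) (cong (φ̄ (g i) ⊞_) (φ̄-∑ g is))

-- Conjugation enters here: `φ̄` of a sum is `φ` of the conjugate sum, so that the conjugate lies in
-- Q exactly when the sum lies in Q̄.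
φ̄-∑-ζpow : ∀ {I : Set} (k : I → ℕ) is → φ̄ (ℤⁿ.∑ is (ζpow ∘ k)) ≡ φ (ℤⁿ.∑ is (λ x → ζpow (41 * k x)))
φ̄-∑-ζpow k is = begin
  φ̄ (ℤⁿ.∑ is (ζpow ∘ k))                   ≡⟨ φ̄-∑ (ζpow ∘ k) is ⟩
  ∑ is (φ̄ ∘ ζpow ∘ k)                      ≡⟨ 𝔽₂ⁿ.∑-cong pointwise is ⟩
  ∑ is (λ x → φ (ζpow (41 * k x)))          ≡⟨ φ-∑ (λ x → ζpow (41 * k x)) is ⟨
  φ (ℤⁿ.∑ is (λ x → ζpow (41 * k x)))       ∎
  where
  pointwise : ∀ x → φ̄ (ζpow (k x)) ≡ φ (ζpow (41 * k x))
  pointwise x = begin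
    φ̄ (ζpow (k x))       ≡⟨ cong φ̄ (ζpow≡ζ^ (k x)) ⟩
    φ̄ (ζ^ (k x))         ≡⟨ φ̄-ζ^ (k x) ⟩
    θ^ (41 * k x)         ≡⟨ φ-ζ^ (41 * k x) ⟨
    φ (ζ^ (41 * k x))     ≡⟨ cong φ (ζpow≡ζ^ (41 * k x)) ⟨
    φ (ζpow (41 * k x))   ∎

-- The norm equations modulo Q

-- The prime 2 divides 42 only once: after cancelling it, `w ⊗ t` is 21, which is odd and hence maps
-- to `𝟙`.
cofactor-of-2-nonzero : ∀ w t → scale (+ 2) w ⊗ t ≡ fortytwo → φ t ≢ 𝟘
cofactor-of-2-nonzero w t 2wt≡42 φt≡0 = 𝟙≢𝟘 (begin
  𝟙            ≡⟨ φ21≡𝟙 ⟨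
  φ twentyone  ≡⟨ cong φ wt≡21 ⟨
  φ (w ⊗ t)    ≡⟨ φ-⊗ w t ⟩
  φ w · φ t    ≡⟨ cong (φ w ·_) φt≡0 ⟩
  φ w · 𝟘      ≡⟨ ·-zeroʳ (φ w) ⟩
  𝟘            ∎)
  where
  twentyone : Cyc
  twentyone = + 21 ∷ ℤⁿ.𝟘

  φ21≡𝟙 : φ twentyone ≡ 𝟙
  φ21≡𝟙 = toWitness {a? = φ twentyone ≟ᵛ 𝟙} tt

  wt≡21 : w ⊗ t ≡ twentyone
  wt≡21 = double-injective (w ⊗ t) twentyone
            (trans (sym (ℤⁿ.IsLinear.homogeneous (⊗-linearˡ t) (+ 2) w)) 2wt≡42)

  𝟙≢𝟘 : 𝟙 ≢ 𝟘
  𝟙≢𝟘 ()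

-- By the hypothesis on `φ̄ s`, the vanishing of `φ t` puts `s` into Q̄; together with `φ s ≡ 𝟘`
-- this makes `s` divisible by 2.
not-both-zero : ∀ s t → s ⊗ t ≡ fortytwo → φ̄ s ≡ φ t → φ s ≡ 𝟘 → φ t ≢ 𝟘
not-both-zero s t st≡42 φ̄s≡φt φs≡0 φt≡0 = cofactor-of-2-nonzero w t (trans (cong (_⊗ t) (sym s≡2w)) st≡42) φt≡0
  where
  half : ∃ λ w → s ≡ scale (+ 2) w
  half = kernels-meet-in-2 s φs≡0 (trans φ̄s≡φt φt≡0)
  w = proj₁ half
  s≡2w = proj₂ half

φ42≡𝟘 : φ fortytwo ≡ 𝟘
φ42≡𝟘 = toWitness {a? = φ fortytwo ≟ᵛ 𝟘} tt

-- Modulo Q, (a + b)(c + d) ≡ 0 kills one factor, say a ≡ b (characteristic 2);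
-- then ac + bd ≡ 0 reads a(c + d) ≡ 0, and c + d cannot vanish as well.
even-norm : ∀ a b c d → (a ⊕ b) ⊗ (c ⊕ d) ≡ fortytwo → (a ⊕ (⊖ b)) ⊗ (c ⊕ (⊖ d)) ≡ fortytwo →
            φ̄ (a ⊕ b) ≡ φ (c ⊕ d) → φ a · φ c ≡ 𝟘
even-norm a b c d plus minus conj = cases (·-integral (φ (a ⊕ b)) (φ (c ⊕ d)) (trans (sym (φ-⊗ (a ⊕ b) (c ⊕ d))) (trans (cong φ plus) φ42≡𝟘)))
  where
  ac+bd : φ a · φ c ⊞ φ b · φ d ≡ 𝟘
  ac+bd = begin
    φ a · φ c ⊞ φ b · φ d     ≡⟨ cong₂ _⊞_ (φ-⊗ a c) (φ-⊗ b d) ⟨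
    φ (a ⊗ c) ⊞ φ (b ⊗ d)     ≡⟨ φ-⊕ (a ⊗ c) (b ⊗ d) ⟨
    -- `fortytwo ⊕ fortytwo` and `scale (+ 2) fortytwo` both compute to 84, so halving leaves
    -- exactly 42.
    φ ((a ⊗ c) ⊕ (b ⊗ d))     ≡⟨ cong φ (double-injective _ fortytwo
                                    (trans (sym (parallelogram a b c d)) (cong₂ _⊕_ plus minus))) ⟩
    φ fortytwo                ≡⟨ φ42≡𝟘 ⟩
    𝟘                         ∎

  cases : φ (a ⊕ b) ≡ 𝟘 ⊎ φ (c ⊕ d) ≡ 𝟘 → φ a · φ c ≡ 𝟘
  cases (inj₁ s≡0) = conclude (·-integral (φ a) (φ (c ⊕ d)) (begin
    φ a · φ (c ⊕ d)           ≡⟨ cong (φ a ·_) (φ-⊕ c d) ⟩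
    φ a · (φ c ⊞ φ d)         ≡⟨ IsLinear.additive (·-linearʳ (φ a)) (φ c) (φ d) ⟩
    φ a · φ c ⊞ φ a · φ d     ≡⟨ cong (λ p → φ a · φ c ⊞ p · φ d) (⊞≡𝟘⇒≡ (φ a) (φ b) (trans (sym (φ-⊕ a b)) s≡0)) ⟩
    φ a · φ c ⊞ φ b · φ d     ≡⟨ ac+bd ⟩
    𝟘                         ∎))
    where
    conclude : φ a ≡ 𝟘 ⊎ φ (c ⊕ d) ≡ 𝟘 → φ a · φ c ≡ 𝟘
    conclude (inj₁ a≡0) = trans (cong (_· φ c) a≡0) (·-zeroˡ (φ c))
    conclude (inj₂ t≡0) = contradiction t≡0 (not-both-zero (a ⊕ b) (c ⊕ d) plus conj s≡0)
  cases (inj₂ t≡0) = conclude (·-integral (φ (a ⊕ b)) (φ c) (begin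
    φ (a ⊕ b) · φ c           ≡⟨ cong (_· φ c) (φ-⊕ a b) ⟩
    (φ a ⊞ φ b) · φ c         ≡⟨ IsLinear.additive (·-linearˡ (φ c)) (φ a) (φ b) ⟩
    φ a · φ c ⊞ φ b · φ c     ≡⟨ cong (λ p → φ a · φ c ⊞ φ b · p) (⊞≡𝟘⇒≡ (φ c) (φ d) (trans (sym (φ-⊕ c d)) t≡0)) ⟩
    φ a · φ c ⊞ φ b · φ d     ≡⟨ ac+bd ⟩
    𝟘                         ∎))
    where
    conclude : φ (a ⊕ b) ≡ 𝟘 ⊎ φ c ≡ 𝟘 → φ a · φ c ≡ 𝟘
    conclude (inj₁ s≡0) = contradiction t≡0 (not-both-zero (a ⊕ b) (c ⊕ d) plus conj s≡0)
    conclude (inj₂ c≡0) = trans (cong (φ a ·_) c≡0) (·-zeroʳ (φ a))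

-- Parseval in 𝔽₆₄

-- Opaque, so that conversion checking does not unroll the 42-fold sums.
opaque
  residues : List (Fin 42)
  residues = allFin 42

  characters : List (Fin 21)
  characters = allFin 21

  Σ42≡∑ : ∀ g → Σ42 g ≡ ℤⁿ.∑ residues g
  Σ42≡∑ g = refl

-- The identity matrix on the even residues. The nesting follows the conditionals of `evenθ`, so one
-- case split reduces both.
δ : Fin 42 → Fin 42 → 𝔽₆₄
δ x y = if odd (toℕ x) then 𝟘 else (if odd (toℕ y) then 𝟘 else (if does (x Fin.≟ y) then 𝟙 else 𝟘))

opaque
  unfolding θ^ residues

  -- As 41 is -1 modulo 42, this is the geometric sum of θ^(y-x) over 21 exponents, and θ has order
  -- 21. For even x and y, 21 divides y - x only if x = y, and then the sum is 21 = 1. Without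
  -- evenness x and x + 21 could not be told apart. Exponents are reduced because they would
  -- otherwise exceed a million.
  orthogonality-% : ∀ (x y : Fin 42) → odd (toℕ x) ≡ false → odd (toℕ y) ≡ false →
                    ∑ characters (λ l → θ^ ((toℕ (l ↑ˡ 21) * (41 * (toℕ x + 41 * toℕ y))) % 42))
                    ≡ (if does (x Fin.≟ y) then 𝟙 else 𝟘)
  orthogonality-% = toWitness
    {a? = Fin.all? λ x → Fin.all? λ y → (odd (toℕ x) Bool.≟ false) →-dec ((odd (toℕ y) Bool.≟ false) →-dec
            (∑ characters (λ l → θ^ ((toℕ (l ↑ˡ 21) * (41 * (toℕ x + 41 * toℕ y))) % 42))
             ≟ᵛ (if does (x Fin.≟ y) then 𝟙 else 𝟘)))} tt

  -- There are 21 even residues, an odd number.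
  ∑-δ : ∑ residues (λ x → ∑ residues (δ x)) ≡ 𝟙
  ∑-δ = toWitness {a? = ∑ residues (λ x → ∑ residues (δ x)) ≟ᵛ 𝟙} tt

orthogonality : ∀ (x y : Fin 42) → odd (toℕ x) ≡ false → odd (toℕ y) ≡ false →
                ∑ characters (λ l → θ^ (toℕ (l ↑ˡ 21) * (41 * (toℕ x + 41 * toℕ y))))
                ≡ (if does (x Fin.≟ y) then 𝟙 else 𝟘)
orthogonality x y x-even y-even =
  trans (𝔽₂ⁿ.∑-cong (λ l → θ^-%42 (toℕ (l ↑ˡ 21) * (41 * (toℕ x + 41 * toℕ y)))) characters)
        (orthogonality-% x y x-even y-even)

·-∑ : ∀ {I J : Set} (g : I → 𝔽₆₄) (h : J → 𝔽₆₄) is js → ∑ is g · ∑ js h ≡ ∑ is (λ i → ∑ js (λ j → g i · h j))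
·-∑ g h is js = trans (𝔽₂ⁿ.linear-∑ (·-linearˡ (∑ js h)) g is)
                      (𝔽₂ⁿ.∑-cong (λ i → 𝔽₂ⁿ.linear-∑ (·-linearʳ (g i)) h js) is)

evenθ : (Fin 42 → ℕ) → Fin 42 → 𝔽₆₄
evenθ k x = if odd (toℕ x) then 𝟘 else θ^ (k x)

φ-evenTerm : ∀ k is → φ (ℤⁿ.∑ is (evenTerm k)) ≡ ∑ is (evenθ k)
φ-evenTerm k is = trans (φ-∑ (evenTerm k) is) (𝔽₂ⁿ.∑-cong (λ x → pointwise (odd (toℕ x)) x) is)
  where
  pointwise : ∀ b x → φ (if b then zeroC else ζ^ (k x)) ≡ (if b then 𝟘 else θ^ (k x))
  pointwise false x = φ-ζ^ (k x)
  -- The empty sum supplies `φ zeroC ≡ 𝟘`.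
  pointwise true  x = φ-∑ (evenTerm k) []

module Parseval (f : Fin 42 → Fin 42) where

  k k̄ : Fin 21 → Fin 42 → ℕ
  k l x = expo f (l ↑ˡ 21) x
  k̄ l x = 41 * k l x

  -- Isolates the dependence on `l`, so that the factor coming from `f` can leave the sum over
  -- characters. The identity is polynomial in `n`, which stands for 41.
  collect : ∀ n F G l x y → (F + n * (l * x)) + n * (G + n * (l * y)) ≡ (F + n * G) + l * (n * (x + n * y))
  collect = solve-∀

  summand : ∀ x y l → θ^ (k l x) · θ^ (k̄ l y) ≡
            θ^ (toℕ (f x) + 41 * toℕ (f y)) · θ^ (toℕ (l ↑ˡ 21) * (41 * (toℕ x + 41 * toℕ y)))
  summand x y l = begin
    θ^ (k l x) · θ^ (k̄ l y)
      ≡⟨ θ^-+ (k l x) (k̄ l y) ⟨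
    θ^ (k l x + k̄ l y)
      ≡⟨ cong θ^ (collect 41 (toℕ (f x)) (toℕ (f y)) (toℕ (l ↑ˡ 21)) (toℕ x) (toℕ y)) ⟩
    θ^ ((toℕ (f x) + 41 * toℕ (f y)) + toℕ (l ↑ˡ 21) * (41 * (toℕ x + 41 * toℕ y)))
      ≡⟨ θ^-+ (toℕ (f x) + 41 * toℕ (f y)) (toℕ (l ↑ˡ 21) * (41 * (toℕ x + 41 * toℕ y))) ⟩
    θ^ (toℕ (f x) + 41 * toℕ (f y)) · θ^ (toℕ (l ↑ˡ 21) * (41 * (toℕ x + 41 * toℕ y))) ∎

  -- For x = y the exponent is 42 f(x), the counterpart of a root of unity having absolute value 1.
  -- This removes `f` from the result.
  diagonal : ∀ x y (x≟y : Dec (x ≡ y)) →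
             θ^ (toℕ (f x) + 41 * toℕ (f y)) · (if does x≟y then 𝟙 else 𝟘) ≡ (if does x≟y then 𝟙 else 𝟘)
  diagonal x .x (yes refl) = begin
    θ^ (toℕ (f x) + 41 * toℕ (f x)) · 𝟙   ≡⟨ cong (λ n → θ^ n · 𝟙) (ℕ.*-comm 42 (toℕ (f x))) ⟩
    θ^ (toℕ (f x) * 42) · 𝟙               ≡⟨ cong (_· 𝟙) (θ^-*42 (toℕ (f x))) ⟩
    𝟙 · 𝟙                                 ≡⟨ ·-identityˡ 𝟙 ⟩
    𝟙                                     ∎
  diagonal x y  (no _)     = ·-zeroʳ (θ^ (toℕ (f x) + 41 * toℕ (f y)))

  correlation : ∀ x y → ∑ characters (λ l → evenθ (k l) x · evenθ (k̄ l) y) ≡ δ x y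
  -- The parities are passed together with their equations: the conditionals reduce on the values,
  -- and `orthogonality` takes the equations.
  correlation x y = cases (odd (toℕ x)) (odd (toℕ y)) refl refl
    where
    cases : ∀ b c → odd (toℕ x) ≡ b → odd (toℕ y) ≡ c →
            ∑ characters (λ l → (if b then 𝟘 else θ^ (k l x)) · (if c then 𝟘 else θ^ (k̄ l y)))
            ≡ (if b then 𝟘 else (if c then 𝟘 else (if does (x Fin.≟ y) then 𝟙 else 𝟘)))
    cases true  c     _ _ = trans (𝔽₂ⁿ.∑-cong (λ l → ·-zeroˡ (if c then 𝟘 else θ^ (k̄ l y))) characters) (𝔽₂ⁿ.∑-𝟘 characters)
    cases false true  _ _ = trans (𝔽₂ⁿ.∑-cong (λ l → ·-zeroʳ (θ^ (k l x))) characters) (𝔽₂ⁿ.∑-𝟘 characters)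
    cases false false x-even y-even = begin
      ∑ characters (λ l → θ^ (k l x) · θ^ (k̄ l y))
        ≡⟨ 𝔽₂ⁿ.∑-cong (summand x y) characters ⟩
      ∑ characters (λ l → θ^ c · θ^ (toℕ (l ↑ˡ 21) * d))
        ≡⟨ 𝔽₂ⁿ.linear-∑ (·-linearʳ (θ^ c)) (λ l → θ^ (toℕ (l ↑ˡ 21) * d)) characters ⟨
      θ^ c · ∑ characters (λ l → θ^ (toℕ (l ↑ˡ 21) * d))
        ≡⟨ cong (θ^ c ·_) (orthogonality x y x-even y-even) ⟩
      θ^ c · (if does (x Fin.≟ y) then 𝟙 else 𝟘)
        ≡⟨ diagonal x y (x Fin.≟ y) ⟩
      (if does (x Fin.≟ y) then 𝟙 else 𝟘) ∎
      where
      c = toℕ (f x) + 41 * toℕ (f y)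
      d = 41 * (toℕ x + 41 * toℕ y)

  parseval : ∑ characters (λ l → ∑ residues (evenθ (k l)) · ∑ residues (evenθ (k̄ l))) ≡ 𝟙
  parseval = begin
    ∑ characters (λ l → ∑ residues (evenθ (k l)) · ∑ residues (evenθ (k̄ l)))
      ≡⟨ 𝔽₂ⁿ.∑-cong (λ l → ·-∑ (evenθ (k l)) (evenθ (k̄ l)) residues residues) characters ⟩
    ∑ characters (λ l → ∑ residues (λ x → ∑ residues (λ y → evenθ (k l) x · evenθ (k̄ l) y)))
      ≡⟨ 𝔽₂ⁿ.∑-comm (λ l x → ∑ residues (λ y → evenθ (k l) x · evenθ (k̄ l) y)) characters residues ⟩
    ∑ residues (λ x → ∑ characters (λ l → ∑ residues (λ y → evenθ (k l) x · evenθ (k̄ l) y)))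
      ≡⟨ 𝔽₂ⁿ.∑-cong (λ x → 𝔽₂ⁿ.∑-comm (λ l y → evenθ (k l) x · evenθ (k̄ l) y) characters residues) residues ⟩
    ∑ residues (λ x → ∑ residues (λ y → ∑ characters (λ l → evenθ (k l) x · evenθ (k̄ l) y)))
      ≡⟨ 𝔽₂ⁿ.∑-cong (λ x → 𝔽₂ⁿ.∑-cong (correlation x) residues) residues ⟩
    ∑ residues (λ x → ∑ residues (δ x))
      ≡⟨ ∑-δ ⟩
    𝟙 ∎

-- The contradiction for a bent function

module Bent (f : Fin 42 → Fin 42) (bent : IsGBent[1,42] f) where
  open Parseval f

  shift : ∀ n F l x → F + n * ((21 + l) * x) ≡ (F + n * (l * x)) + (n * x) * 21
  shift = solve-∀

  -- `l ↑ˡ 21` and `21 ↑ʳ l` are the residues l and l + 21. The exponent grows by 21 taken 41 x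
  -- times, and 41 x has the parity of x.
  expo-shift : ∀ l x → expo f (21 ↑ʳ l) x ≡ k l x + (41 * toℕ x) * 21
  expo-shift l x = begin
    toℕ (f x) + 41 * (toℕ (21 ↑ʳ l) * toℕ x)
      ≡⟨ cong (λ j → toℕ (f x) + 41 * (j * toℕ x)) (trans (Fin.toℕ-↑ʳ 21 l) (cong (λ j → 21 + j) (sym (Fin.toℕ-↑ˡ l 21)))) ⟩
    toℕ (f x) + 41 * ((21 + toℕ (l ↑ˡ 21)) * toℕ x)
      ≡⟨ shift 41 (toℕ (f x)) (toℕ (l ↑ˡ 21)) (toℕ x) ⟩
    k l x + (41 * toℕ x) * 21 ∎

  distribute : ∀ n a b → n * (a + b * 21) ≡ n * a + (n * b) * 21
  distribute = solve-∀

  expo-shift-conj : ∀ l x → 41 * expo f (21 ↑ʳ l) x ≡ k̄ l x + (41 * (41 * toℕ x)) * 21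
  expo-shift-conj l x = trans (cong (41 *_) (expo-shift l x)) (distribute 41 (k l x) (41 * toℕ x))

  vanishing : ∀ l → ∑ residues (evenθ (k l)) · ∑ residues (evenθ (k̄ l)) ≡ 𝟘
  vanishing l = begin
    ∑ residues (evenθ (k l)) · ∑ residues (evenθ (k̄ l))
      ≡⟨ cong₂ _·_ (φ-evenTerm (k l) residues) (φ-evenTerm (k̄ l) residues) ⟨
    φ A · φ Ā
      ≡⟨ even-norm A B Ā B̄
           (trans (cong₂ _⊗_ (sym (trans (Σ42≡∑ _) split)) (sym (trans (Σ42≡∑ _) split-conj))) (bent (l ↑ˡ 21)))
           (trans (cong₂ _⊗_ (sym (trans (Σ42≡∑ _) split-shifted)) (sym (trans (Σ42≡∑ _) split-shifted-conj))) (bent (21 ↑ʳ l)))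
           -- Links A + B to its conjugate modulo Q, as `not-both-zero` demands.
           (trans (cong φ̄ (sym split)) (trans (φ̄-∑-ζpow (k l) residues) (cong φ split-conj))) ⟩
    𝟘 ∎
    where
    A = ℤⁿ.∑ residues (evenTerm (k l))
    B = ℤⁿ.∑ residues (oddTerm (k l))
    Ā = ℤⁿ.∑ residues (evenTerm (k̄ l))
    B̄ = ℤⁿ.∑ residues (oddTerm (k̄ l))

    split : ℤⁿ.∑ residues (λ x → ζpow (k l x)) ≡ A ⊕ B
    split = ∑-split (k l) residues

    split-conj : ℤⁿ.∑ residues (λ x → ζpow (k̄ l x)) ≡ Ā ⊕ B̄
    split-conj = ∑-split (k̄ l) residues

    split-shifted : ℤⁿ.∑ residues (λ x → ζpow (expo f (21 ↑ʳ l) x)) ≡ A ⊕ (⊖ B)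
    split-shifted = ∑-split-shifted (k l) (expo f (21 ↑ʳ l)) (λ x → 41 * toℕ x) (expo-shift l) (λ x → odd-* 41 (toℕ x)) residues

    split-shifted-conj : ℤⁿ.∑ residues (λ x → ζpow (41 * expo f (21 ↑ʳ l) x)) ≡ Ā ⊕ (⊖ B̄)
    split-shifted-conj = ∑-split-shifted (k̄ l) (λ x → 41 * expo f (21 ↑ʳ l) x) (λ x → 41 * (41 * toℕ x)) (expo-shift-conj l)
      (λ x → trans (odd-* 41 (41 * toℕ x)) (odd-* 41 (toℕ x))) residues

  𝟘≡𝟙 : 𝟘 ≡ 𝟙
  𝟘≡𝟙 = begin
    𝟘                                                                           ≡⟨ 𝔽₂ⁿ.∑-𝟘 characters ⟨
    ∑ characters (const 𝟘)                                                      ≡⟨ 𝔽₂ⁿ.∑-cong vanishing characters ⟨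
    ∑ characters (λ l → ∑ residues (evenθ (k l)) · ∑ residues (evenθ (k̄ l)))    ≡⟨ parseval ⟩
    𝟙                                                                           ∎

theorem4 : ¬ (Σ (Fin 42 → Fin 42) IsGBent[1,42])
theorem4 (f , bent) = contradiction (Bent.𝟘≡𝟙 f bent) λ ()
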